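{- $N(48) \ge 10$; that is, there exist $10$ mutually orthogonal Latin squares of order $48$.
   Context: A Latin square of order $n$ on an $n$-element set $V$ is an $n\times n$ matrix every row and every column of which is a permutation of $V$. Two Latin squares $L_1=(v_{ij})$ and $L_2=(w_{ij})$ of order $n$ (on symbol sets $V$, $W$ of size $n$) are orthogonal if the $n^2$ pairs $(v_{ij},w_{ij})$ are all distinct, i.e. they exhaust $V\times W$. A set of Latin squares is a set of mutually orthogonal Latin squares (MOLS) if any two of them are orthogonal. $N(n)$ denotes the largest size of a set of MOLS of order $n$. -}

module Defs where

open import Data.Nat using (ℕ)
open import Data.Fin using (Fin)
open import Data.Product using (_×_; _,_)
open import Function.Definitions using (Bijective; Injective)
open import Relation.Binary.PropositionalEquality using (_≡_)
open import Relation.Nullary using (¬_)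

Square : ℕ → Set
Square n = Fin n → Fin n → Fin n

IsLatin : {n : ℕ} → Square n → Set
IsLatin {n} L =
  ((i : Fin n) → Bijective _≡_ _≡_ (λ j → L i j)) ×
  ((j : Fin n) → Bijective _≡_ _≡_ (λ i → L i j))

Orthogonal : {n : ℕ} → Square n → Square n → Set
Orthogonal {n} L₁ L₂ =
  Injective {A = Fin n × Fin n} _≡_ _≡_ (λ { (i , j) → (L₁ i j , L₂ i j) })

IsMOLS : {n k : ℕ} → (Fin k → Square n) → Set
IsMOLS {n} {k} F =
  ((a : Fin k) → IsLatin (F a)) ×
  ((a b : Fin k) → ¬ (a ≡ b) → Orthogonal (F a) (F b))

{-# OPTIONS --safe #-}

-- Let G be a group of order n.  If k rows of length n over G are such that
-- every row, and every quotient of two distinct rows, lists each element of G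
-- exactly once (a difference matrix whose constant first row is omitted), then
-- the squares L_a(g , j) = D_a(j) g are k MOLS of order n: the quotient of the
-- entries of L_a and L_b at (g , j) does not depend on g and determines j.
--
-- For n = 48 we take G = ℤ₂⁴ × ℤ₃ and k = 10.  The 48 columns are 12 base
-- columns, each translated by the four elements of K = ℤ₂², where k ∈ K adds
-- φ_a(k) to row a for homomorphisms φ_a : K → ℤ₂⁴ such that all φ_a and all
-- φ_a - φ_b with a ≠ b are injective.  The ℤ₃-parts of the base columns come
-- from the generalised Hadamard matrix GH(12; ℤ₃) with one row deleted.  Given
-- these, requiring invariance under a group S₃ acting on the rows with orbits
-- of lengths 2, 6, 3 makes the ℤ₂⁴-parts accessible to a computer search.
module Submission where

open import Defs
open import Data.Product using (Σ)
open import Data.Fin using (Fin)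

open import Algebra.Bundles using (Group)
open import Algebra.Construct.DirectProduct using (group)
import Algebra.Properties.Group as GroupProperties
open import Data.Fin using (toℕ; remQuot; punchOut)
open import Data.Fin.Properties using (_≟_; all?; any?; toℕ-fromℕ<; toℕ-injective; toℕ<n; injective⇒≤; punchOut-injective; *↔×)
open import Data.Nat as ℕ using (ℕ; NonZero; _%_; _∸_)
import Data.Nat.Properties as ℕ
open import Data.Nat.DivMod using (_mod_; m%n<n; m%n%n≡m%n; m<n⇒m%n≡m; n%n≡0; %-distribˡ-+)
open import Data.Product using (_×_; _,_; proj₁; proj₂)
open import Data.Product.Function.NonDependent.Setoid using (_×-inverse_)
open import Data.Product.Relation.Binary.Pointwise.NonDependent using (Pointwise-≡↔≡)
open import Data.Vec using (Vec; []; _∷_; lookup; tabulate)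
open import Data.Vec.Properties using (lookup∘tabulate)
open import Data.Vec.Relation.Unary.AllPairs using (allPairs?)
open import Data.Vec.Relation.Unary.Unique.Propositional using (Unique)
open import Data.Vec.Relation.Unary.Unique.Propositional.Properties using (lookup-injective)
open import Function.Bundles using (Inverse)
open import Function.Definitions using (Injective; Bijective; Surjective)
import Function.Construct.Composition as Composition
import Function.Construct.Identity as Identity
import Function.Construct.Symmetry as Symmetry
open import Level using (0ℓ)
open import Relation.Binary.PropositionalEquality as ≡ using (_≡_; _≢_; refl; sym; trans; cong; cong₂)
open import Relation.Nullary using (Dec; yes; no; ¬?; contradiction; _→-dec_)
open import Relation.Nullary.Decidable using (from-yes)

-- Pigeonhole: a missed value `y` could be punched out of the codomain, leaving an injection of
-- `Fin (suc n)` into `Fin n`.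
injective⇒surjective : ∀ {n} {f : Fin n → Fin n} → Injective _≡_ _≡_ f → Surjective _≡_ _≡_ f
injective⇒surjective {ℕ.suc n} {f} inj y with any? (λ x → f x ≟ y)
... | yes (x , fx≡y) = x , λ { refl → fx≡y }
... | no y∉f = contradiction (injective⇒≤ punchOut∘f-injective) ℕ.1+n≰n
  where
  y≢f : ∀ x → y ≢ f x
  y≢f x y≡fx = y∉f (x , sym y≡fx)
  punchOut∘f-injective : Injective _≡_ _≡_ (λ x → punchOut (y≢f x))
  punchOut∘f-injective {x} {x′} eq = inj (punchOut-injective (y≢f x) (y≢f x′) eq)

injective⇒bijective : ∀ {n} {f : Fin n → Fin n} → Injective _≡_ _≡_ f → Bijective _≡_ _≡_ f
injective⇒bijective inj = inj , injective⇒surjective inj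

FinEnumeration : ∀ {c ℓ} → ℕ → Group c ℓ → Set _
FinEnumeration n G = Inverse (≡.setoid (Fin n)) (Group.setoid G)

-- Latin squares from a difference matrix over a finite group.

module DifferenceMatrix {c ℓ} (G : Group c ℓ) {n : ℕ} (enum : FinEnumeration n G) where
  open Group G renaming (refl to ≈-refl; sym to ≈-sym; trans to ≈-trans)
  open GroupProperties G using (∙-cancelˡ; ∙-cancelʳ; ⁻¹-anti-homo-∙)
  open Inverse enum using (to; from; from-cong) renaming (inverseˡ to to∘from; inverseʳ to from∘to)
  open import Relation.Binary.Reasoning.Setoid setoid

  -- The rows of a difference matrix other than its constant row ε.
  IsDifferenceMatrix : ∀ {k} → (Fin k → Fin n → Carrier) → Set _
  IsDifferenceMatrix {k} D =
    ((a : Fin k) → Injective _≡_ _≈_ (D a)) ×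
    ((a b : Fin k) → a ≢ b → Injective _≡_ _≈_ (λ j → D a j // D b j))

  square : (Fin n → Carrier) → Square n
  square d i j = from (d j ∙ to i)

  from-injective : Injective _≈_ _≡_ from
  from-injective eq = ≈-trans (≈-sym (to∘from refl)) (to∘from eq)

  to-injective : Injective _≡_ _≈_ to
  to-injective eq = trans (sym (from∘to ≈-refl)) (from∘to eq)

  ∙-//-cancel : ∀ x y z → (x ∙ z) // (y ∙ z) ≈ x // y
  ∙-//-cancel x y z = begin
    (x ∙ z) ∙ (y ∙ z) ⁻¹     ≈⟨ ∙-congˡ (⁻¹-anti-homo-∙ y z) ⟩
    (x ∙ z) ∙ (z ⁻¹ ∙ y ⁻¹)  ≈⟨ assoc x z _ ⟩
    x ∙ (z ∙ (z ⁻¹ ∙ y ⁻¹))  ≈⟨ ∙-congˡ (≈-sym (assoc z _ _)) ⟩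
    x ∙ ((z ∙ z ⁻¹) ∙ y ⁻¹)  ≈⟨ ∙-congˡ (∙-congʳ (inverseʳ z)) ⟩
    x ∙ (ε ∙ y ⁻¹)           ≈⟨ ∙-congˡ (identityˡ _) ⟩
    x ∙ y ⁻¹                 ∎

  square-row-injective : ∀ {d} → Injective _≡_ _≈_ d → ∀ i → Injective _≡_ _≡_ (square d i)
  square-row-injective d-inj i eq = d-inj (∙-cancelʳ (to i) _ _ (from-injective eq))

  square-column-injective : ∀ d j → Injective _≡_ _≡_ (λ i → square d i j)
  square-column-injective d j eq = to-injective (∙-cancelˡ (d j) _ _ (from-injective eq))

  square-latin : ∀ {d} → Injective _≡_ _≈_ d → IsLatin (square d)
  square-latin {d} d-inj =
    (λ i → injective⇒bijective (square-row-injective d-inj i)) ,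
    (λ j → injective⇒bijective (square-column-injective d j))

  -- The factor `to i` stands on the right of both entries, so it cancels in their quotient, which
  -- depends on the column alone.
  //-determined : ∀ d e {i j i′ j′} → square d i j ≡ square d i′ j′ → square e i j ≡ square e i′ j′ → d j // e j ≈ d j′ // e j′
  //-determined d e {i} {j} {i′} {j′} p q = begin
    d j // e j                        ≈⟨ ≈-sym (∙-//-cancel (d j) (e j) (to i)) ⟩
    (d j ∙ to i) // (e j ∙ to i)      ≈⟨ ∙-cong (from-injective p) (⁻¹-cong (from-injective q)) ⟩
    (d j′ ∙ to i′) // (e j′ ∙ to i′)  ≈⟨ ∙-//-cancel (d j′) (e j′) (to i′) ⟩
    d j′ // e j′                      ∎

  square-orthogonal : ∀ {d e} → Injective _≡_ _≈_ (λ j → d j // e j) → Orthogonal (square d) (square e)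
  square-orthogonal {d} {e} d//e-inj {i , j} {i′ , j′} eq
    -- Equal pairs have equal quotients, which forces `j ≡ j′`; the row index is then recovered
    -- within that one column.
    with refl ← d//e-inj (//-determined d e {i} {j} {i′} {j′} (cong proj₁ eq) (cong proj₂ eq))
    = cong (_, j) (square-column-injective d j (cong proj₁ eq))

  squares-areMOLS : ∀ {k} {D : Fin k → Fin n → Carrier} → IsDifferenceMatrix D → IsMOLS (λ a → square (D a))
  squares-areMOLS (rows , quotients) =
    (λ a → square-latin (rows a)) ,
    (λ a b a≢b → square-orthogonal (quotients a b a≢b))

  -- Passing to naturals reduces distinctness in the group to built-in comparison of numbers.
  codes : (Fin n → Carrier) → Vec ℕ n
  codes f = tabulate (λ j → toℕ (from (f j)))

  unique-codes⇒injective : ∀ {f} → Unique (codes f) → Injective _≡_ _≈_ f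
  unique-codes⇒injective {f} u {i} {j} fi≈fj = lookup-injective u i j
    (trans (lookup∘tabulate _ i) (trans (cong toℕ (from-cong fi≈fj)) (sym (lookup∘tabulate _ j))))

  unique-codes? : ∀ f → Dec (Unique (codes f))
  unique-codes? f = allPairs? (λ x y → ¬? (x ℕ.≟ y)) (codes f)

-- The cyclic group of order m.

module Cyclic (m : ℕ) .{{_ : NonZero m}} where

  infixl 6 _⊕_
  _⊕_ : Fin m → Fin m → Fin m
  i ⊕ j = (toℕ i ℕ.+ toℕ j) mod m

  -- The reduction matters only when `toℕ i` is 0, where `m ∸ 0` is out of range.
  ⊖_ : Fin m → Fin m
  ⊖ i = (m ∸ toℕ i) mod m

  toℕ-mod : ∀ x → toℕ (x mod m) ≡ x % m
  toℕ-mod x = toℕ-fromℕ< (m%n<n x m)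

  toℕ-% : ∀ (i : Fin m) → toℕ i % m ≡ toℕ i
  toℕ-% i = m<n⇒m%n≡m (toℕ<n i)

  %-+ˡ : ∀ x y → (x % m ℕ.+ y) % m ≡ (x ℕ.+ y) % m
  %-+ˡ x y = trans (%-distribˡ-+ (x % m) y m) (trans (cong (λ z → (z ℕ.+ y % m) % m) (m%n%n≡m%n x m)) (sym (%-distribˡ-+ x y m)))

  %-+ʳ : ∀ x y → (x ℕ.+ y % m) % m ≡ (x ℕ.+ y) % m
  %-+ʳ x y = trans (cong (_% m) (ℕ.+-comm x _)) (trans (%-+ˡ y x) (cong (_% m) (ℕ.+-comm y x)))

  ⊕-comm : ∀ i j → i ⊕ j ≡ j ⊕ i
  ⊕-comm i j = cong (_mod m) (ℕ.+-comm (toℕ i) (toℕ j))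

  ⊕-assoc : ∀ i j k → (i ⊕ j) ⊕ k ≡ i ⊕ (j ⊕ k)
  ⊕-assoc i j k = toℕ-injective (begin
    toℕ ((i ⊕ j) ⊕ k)                          ≡⟨ toℕ-mod _ ⟩
    (toℕ (i ⊕ j) ℕ.+ toℕ k) % m                ≡⟨ cong (λ x → (x ℕ.+ toℕ k) % m) (toℕ-mod _) ⟩
    ((toℕ i ℕ.+ toℕ j) % m ℕ.+ toℕ k) % m      ≡⟨ %-+ˡ (toℕ i ℕ.+ toℕ j) (toℕ k) ⟩
    ((toℕ i ℕ.+ toℕ j) ℕ.+ toℕ k) % m          ≡⟨ cong (_% m) (ℕ.+-assoc (toℕ i) (toℕ j) (toℕ k)) ⟩
    (toℕ i ℕ.+ (toℕ j ℕ.+ toℕ k)) % m          ≡⟨ %-+ʳ (toℕ i) (toℕ j ℕ.+ toℕ k) ⟨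
    (toℕ i ℕ.+ (toℕ j ℕ.+ toℕ k) % m) % m      ≡⟨ cong (λ x → (toℕ i ℕ.+ x) % m) (toℕ-mod _) ⟨
    (toℕ i ℕ.+ toℕ (j ⊕ k)) % m                ≡⟨ toℕ-mod _ ⟨
    toℕ (i ⊕ (j ⊕ k))                          ∎)
    where open ≡.≡-Reasoning

  ⊕-identityˡ : ∀ i → (0 mod m) ⊕ i ≡ i
  ⊕-identityˡ i = toℕ-injective (begin
    toℕ ((0 mod m) ⊕ i)           ≡⟨ toℕ-mod _ ⟩
    (toℕ (0 mod m) ℕ.+ toℕ i) % m ≡⟨ cong (λ x → (x ℕ.+ toℕ i) % m) (toℕ-mod 0) ⟩
    (0 % m ℕ.+ toℕ i) % m         ≡⟨ %-+ˡ 0 (toℕ i) ⟩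
    toℕ i % m                     ≡⟨ toℕ-% i ⟩
    toℕ i                         ∎)
    where open ≡.≡-Reasoning

  ⊕-inverseʳ : ∀ i → i ⊕ (⊖ i) ≡ 0 mod m
  ⊕-inverseʳ i = toℕ-injective (begin
    toℕ (i ⊕ (⊖ i))                     ≡⟨ toℕ-mod _ ⟩
    (toℕ i ℕ.+ toℕ (⊖ i)) % m           ≡⟨ cong (λ x → (toℕ i ℕ.+ x) % m) (toℕ-mod _) ⟩
    (toℕ i ℕ.+ (m ∸ toℕ i) % m) % m     ≡⟨ %-+ʳ (toℕ i) (m ∸ toℕ i) ⟩
    (toℕ i ℕ.+ (m ∸ toℕ i)) % m         ≡⟨ cong (_% m) (ℕ.m+[n∸m]≡n (ℕ.<⇒≤ (toℕ<n i))) ⟩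
    m % m                               ≡⟨ n%n≡0 m ⟩
    0                                   ≡⟨ m<n⇒m%n≡m (ℕ.>-nonZero⁻¹ m) ⟨
    0 % m                               ≡⟨ toℕ-mod 0 ⟨
    toℕ (0 mod m)                       ∎)
    where open ≡.≡-Reasoning

  cyclicGroup : Group 0ℓ 0ℓ
  cyclicGroup = record
    { Carrier = Fin m
    ; _≈_     = _≡_
    ; _∙_     = _⊕_
    ; ε       = 0 mod m
    ; _⁻¹     = ⊖_
    ; isGroup = record
      { isMonoid = record
        { isSemigroup = record
          { isMagma = record { isEquivalence = ≡.isEquivalence ; ∙-cong = cong₂ _⊕_ }
          ; assoc   = ⊕-assoc
          }
        ; identity = ⊕-identityˡ , λ i → trans (⊕-comm i _) (⊕-identityˡ i)
        }
      ; inverse = (λ i → trans (⊕-comm _ i) (⊕-inverseʳ i)) , ⊕-inverseʳ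
      ; ⁻¹-cong = cong ⊖_
      }
    }

  cyclicEnumeration : FinEnumeration m cyclicGroup
  cyclicEnumeration = Identity.inverse (≡.setoid (Fin m))

-- The groups ℤ₂^k × ℤ₃ and their enumerations.

×-enumeration : ∀ {c₁ ℓ₁ c₂ ℓ₂} (G : Group c₁ ℓ₁) (H : Group c₂ ℓ₂) {m n} → FinEnumeration m G → FinEnumeration n H → FinEnumeration (m ℕ.* n) (group G H)
-- The middle map trades propositional equality of pairs for componentwise equality.
×-enumeration G H e f = Composition.inverse (Composition.inverse *↔× (Symmetry.inverse Pointwise-≡↔≡)) (e ×-inverse f)

open Cyclic using (cyclicGroup; cyclicEnumeration)

ℤ₂^_×ℤ₃ : ℕ → Group 0ℓ 0ℓ
ℤ₂^ ℕ.zero ×ℤ₃  = cyclicGroup 3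
ℤ₂^ ℕ.suc k ×ℤ₃ = group (cyclicGroup 2) (ℤ₂^ k ×ℤ₃)

-- This is `3 * 2 ^ k`, in the recursive form that `×-enumeration` produces.
order : ℕ → ℕ
order ℕ.zero    = 3
order (ℕ.suc k) = 2 ℕ.* order k

enumeration : ∀ k → FinEnumeration (order k) (ℤ₂^ k ×ℤ₃)
enumeration ℕ.zero    = cyclicEnumeration 3
enumeration (ℕ.suc k) = ×-enumeration (cyclicGroup 2) (ℤ₂^ k ×ℤ₃) (cyclicEnumeration 2) (enumeration k)

-- The explicit difference matrix over ℤ₂⁴ × ℤ₃.

open Group (ℤ₂^ 4 ×ℤ₃) using (Carrier; _∙_; _//_)
open DifferenceMatrix (ℤ₂^ 4 ×ℤ₃) (enumeration 4)

-- An element (v , c) with v ∈ ℤ₂⁴ read as a binary number is written 3 v + c.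
element : ℕ → Carrier
element x = Inverse.to (enumeration 4) (x mod 48)

baseColumns : Vec (Vec ℕ 12) 10
baseColumns =
  (0 ∷ 33 ∷  9 ∷ 37 ∷ 41 ∷ 31 ∷  4 ∷ 19 ∷ 35 ∷ 20 ∷ 14 ∷ 27 ∷ []) ∷
  (0 ∷ 42 ∷ 22 ∷ 29 ∷  1 ∷ 20 ∷  3 ∷ 13 ∷ 10 ∷ 44 ∷ 18 ∷ 11 ∷ []) ∷
  (0 ∷ 22 ∷  6 ∷ 20 ∷ 40 ∷ 33 ∷ 16 ∷ 14 ∷ 15 ∷ 46 ∷ 38 ∷  5 ∷ []) ∷
  (0 ∷ 46 ∷ 38 ∷ 18 ∷ 12 ∷ 13 ∷ 41 ∷  1 ∷ 19 ∷ 24 ∷ 47 ∷ 44 ∷ []) ∷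
  (0 ∷  1 ∷ 35 ∷ 28 ∷ 13 ∷ 11 ∷ 17 ∷  6 ∷ 33 ∷  8 ∷  4 ∷ 18 ∷ []) ∷
  (0 ∷ 37 ∷ 20 ∷ 26 ∷  2 ∷  1 ∷  9 ∷ 39 ∷ 44 ∷ 31 ∷ 33 ∷  4 ∷ []) ∷
  (0 ∷ 47 ∷ 16 ∷ 39 ∷ 43 ∷  8 ∷ 22 ∷ 33 ∷ 11 ∷ 36 ∷  2 ∷ 19 ∷ []) ∷
  (0 ∷ 38 ∷ 34 ∷  4 ∷  5 ∷ 28 ∷ 33 ∷ 32 ∷  6 ∷ 27 ∷ 46 ∷ 14 ∷ []) ∷
  (0 ∷  2 ∷ 46 ∷ 35 ∷ 45 ∷ 36 ∷ 23 ∷ 43 ∷  8 ∷ 16 ∷ 31 ∷ 33 ∷ []) ∷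
  (0 ∷ 32 ∷ 14 ∷ 25 ∷ 39 ∷ 30 ∷ 46 ∷ 47 ∷ 16 ∷  5 ∷ 45 ∷ 34 ∷ []) ∷ []

-- Row a lists the values of φ_a.
shifts : Vec (Vec ℕ 4) 10
shifts =
  (0 ∷  3 ∷ 12 ∷ 15 ∷ []) ∷
  (0 ∷  6 ∷ 33 ∷ 27 ∷ []) ∷
  (0 ∷ 36 ∷  9 ∷ 45 ∷ []) ∷
  (0 ∷ 39 ∷ 21 ∷ 30 ∷ []) ∷
  (0 ∷ 45 ∷ 36 ∷  9 ∷ []) ∷
  (0 ∷ 15 ∷  6 ∷ 21 ∷ []) ∷
  (0 ∷ 30 ∷ 42 ∷ 12 ∷ []) ∷
  (0 ∷  9 ∷ 45 ∷ 36 ∷ []) ∷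
  (0 ∷ 42 ∷ 24 ∷ 18 ∷ []) ∷
  (0 ∷ 27 ∷  3 ∷ 24 ∷ []) ∷ []

-- Column `4 j + k` is base column `j` translated by `k`. A row, or a quotient of two rows, has no
-- repetition because its twelve base entries lie in different cosets of the four-element image of
-- `φ_a`, or of `φ_a - φ_b`.
matrix : Fin 10 → Fin 48 → Carrier
matrix a jk = element (lookup (lookup baseColumns a) j) ∙ element (lookup (lookup shifts a) k)
  where
  j = proj₁ (remQuot {12} 4 jk)
  k = proj₂ (remQuot {12} 4 jk)

rows-unique : ∀ a → Unique (codes (matrix a))
rows-unique = from-yes (all? λ a → unique-codes? (matrix a))

quotients-unique : ∀ a b → a ≢ b → Unique (codes (λ j → matrix a j // matrix b j))
-- Deciding the implication lets the finite search run over all pairs; the diagonal, where the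
-- quotient is constant, holds vacuously.
quotients-unique = from-yes (all? λ a → all? λ b → ¬? (a ≟ b) →-dec unique-codes? (λ j → matrix a j // matrix b j))

matrix-isDifferenceMatrix : IsDifferenceMatrix matrix
matrix-isDifferenceMatrix =
  (λ a → unique-codes⇒injective (rows-unique a)) ,
  (λ a b a≢b → unique-codes⇒injective (quotients-unique a b a≢b))

theorem3 : Σ (Fin 10 → Square 48) IsMOLS
theorem3 = (λ a → square (matrix a)) , squares-areMOLS matrix-isDifferenceMatrix
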